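{- Let $\mathbb{H}$ be an elementary abelian $2$-hypergroup and let $\mathbb{G}\subseteq\mathbb{H}$. Then $\mathbb{G}$ is a closed subset of $\mathbb{H}$ if and only if there exist $r\in\mathrm{Thick}(\mathbb{H})$ and $\mathbb{F}\subseteq\mathbb{H}$ such that $\mathrm{O}^\vartheta(\mathbb{G})=\langle r\rangle$, $\mathbb{F}^\gamma$ is a subgroup of the elementary abelian $2$-group $\mathrm{O}_\vartheta(\mathbb{H})^\gamma$, $\mathbb{G}=\langle r\rangle\mathbb{F}$, $\langle r\rangle\cap\mathbb{F}=\{e\}$, and $\mathrm{O}_\vartheta(\mathbb{G})=\mathbb{F}$.
   Context: A hypergroup is a nonempty set $\mathbb{H}$ with a hypermultiplication $(a,b)\mapsto ab\subseteq\mathbb{H}$ and a map $a\mapsto a^*$ from $\mathbb{H}$ to $\mathbb{H}$ such that, writing $\mathbb{F}\mathbb{G}=\bigcup_{b\in\mathbb{F},c\in\mathbb{G}}bc$ for $\mathbb{F},\mathbb{G}\subseteq\mathbb{H}$ and $a\mathbb{G}=\{a\}\mathbb{G}$, $\mathbb{G}a=\mathbb{G}\{a\}$: (1) $(ab)c=a(bc)$ for all $a,b,c$; (2) there is a unique $e\in\mathbb{H}$ with $ea=\{a\}=ae$ for all $a$; (3) for all $a,b,c$ the conditions $a\in bc$, $b\in ac^*$, $c\in b^*a$ are pairwise equivalent. A nonempty $\mathbb{G}\subseteq\mathbb{H}$ is a closed subset of $\mathbb{H}$ if $\mathbb{G}^*\mathbb{G}\subseteq\mathbb{G}$, where $\mathbb{G}^*=\{a^*:a\in\mathbb{G}\}$.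 For $\mathbb{G}\subseteq\mathbb{H}$, $\langle\mathbb{G}\rangle$ is the intersection of all closed subsets of $\mathbb{H}$ containing $\mathbb{G}$, and $\langle a\rangle=\langle\{a\}\rangle$. An element $a$ is thin if $a^*a=\{e\}$ and thick otherwise. $\mathrm{O}_\vartheta(\mathbb{G})$ is the set of thin elements of $\mathbb{H}$ lying in $\mathbb{G}$. For closed subsets $\mathbb{F},\mathbb{G}$: $\mathbb{F}$ is normal in $\mathbb{G}$ if $\mathbb{F}\subseteq\mathbb{G}$ and $\mathbb{F}a=a\mathbb{F}$ for all $a\in\mathbb{G}$; $\mathbb{F}$ is strongly normal in $\mathbb{G}$ if $a^*\mathbb{F}a\subseteq\mathbb{F}\subseteq\mathbb{G}$ for all $a\in\mathbb{G}$. For $\mathbb{G}\subseteq\mathbb{H}$, $\mathrm{O}^\vartheta(\mathbb{G})$ is the intersection of all strongly normal closed subsets of $\langle\mathbb{G}\rangle$. An involution is an element $a\neq e$ such that $\{e,a\}$ is closed. If $a,b$ are thin, then $ab$ is a singleton $\{c\}$ with $c$ thin. For $\mathbb{G}\subseteq\mathbb{H}$ put $\mathbb{G}^\gamma=\{\{a\}:a\in\mathbb{G}\}$; $\mathrm{O}_\vartheta(\mathbb{H})^\gamma$ carries the binary operation $\{a\}\bullet\{b\}=ab$ with identity $\{e\}$. Elementary abelian $2$-hypergroups: $\mathbb{H}$ is the direct product of normal closed subsets $\mathbb{G}_1,\dots,\mathbb{G}_p$ ($p\geq 1$) if, for each $i$, $\mathbb{H}=\mathbb{G}_i\widehat{\mathbb{G}_i}$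 and $\mathbb{G}_i\cap\widehat{\mathbb{G}_i}=\{e\}$, where $\widehat{\mathbb{G}_i}=\prod_{j\neq i}\mathbb{G}_j$ (and $\widehat{\mathbb{G}_1}=\{e\}$ if $p=1$). Then for every $a\in\mathbb{H}$ there are unique $r_i\in\mathbb{G}_i$ ($1\le i\le p$) with $a\in r_1r_2\cdots r_p$; the set $\{r_1,\dots,r_p\}\setminus\{e\}$ is the support of $a$. The direct product is constrained if $r_1r_2\cdots r_p=\{a\}$ for every $a\in\mathbb{H}$. $\mathbb{H}$ is an elementary abelian $2$-hypergroup if it is the constrained direct product of closed subsets $\langle q_1\rangle,\dots,\langle q_p\rangle$ with $q_1,\dots,q_p$ involutions of $\mathbb{H}$ (so $\langle q_i\rangle=\{e,q_i\}$); $q_1,\dots,q_p$ are fixed and supports are taken with respect to this decomposition. For $\mathbb{F}\subseteq\mathbb{H}$, $\mathrm{Thick}(\mathbb{F})$ is the set of $a\in\mathbb{F}$ such that $a=e$ or all elements in the support of $a$ are thick.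
   Formalization: Thick(F) is taken as the elements a of F with a = e or all elements in the support of a thick; with "thin", as printed in the definition, the theorem fails for G = H = {e,q} with qq = {e,q}. -}

module Defs where

open import Level using (Level; _⊔_; Lift; lift) renaming (suc to lsuc)
open import Algebra.Bundles using (Group; AbelianGroup)
open import Data.Fin.Base using (Fin; zero; suc)
open import Data.Nat.Base using (ℕ; zero; suc)
open import Data.Product.Base using (Σ; ∃; ∃₂; _×_; _,_; proj₁; proj₂)
open import Data.Product using (∃!)
open import Data.Sum.Base using (_⊎_; inj₁; inj₂)
open import Data.Vec.Functional using (removeAt)
open import Function.Base using (_∘_)
open import Function.Bundles using (_⇔_; Equivalence)
open import Relation.Binary.PropositionalEquality
  using (_≡_; _≢_; refl; sym; trans; cong; subst)
open import Relation.Nullary.Negation using (¬_; contradiction)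
open import Relation.Unary
  using (Pred; _∈_; _⊆_; _≐_; _∩_; _∪_; ｛_｝; U; Satisfiable)

private
  variable
    ℓ ℓ₁ ℓ₂ ℓ₃ ℓ₄ : Level

-- A subset is a predicate Pred Carrier ℓ; equality of subsets is _≐_.
-- Operations on subsets are level-polymorphic because an intersection over
-- all subsets (of level ℓ) satisfying a condition lives one universe higher.
-- Nonemptiness of the carrier is provided by the identity element.

record Hypergroup (ℓ : Level) : Set (lsuc ℓ) where
  infixr 7 _·_ _⊙_
  infix  8 _⋆ _⋆ˢ

  field
    Carrier : Set ℓ
    _·_     : Carrier → Carrier → Pred Carrier ℓ
    _⋆      : Carrier → Carrier

  _⊙_ : Pred Carrier ℓ₁ → Pred Carrier ℓ₂ → Pred Carrier (ℓ ⊔ ℓ₁ ⊔ ℓ₂)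
  (F ⊙ G) x = ∃₂ λ b c → b ∈ F × c ∈ G × x ∈ b · c

  field
    assoc    : ∀ a b c → (a · b) ⊙ ｛ c ｝ ≐ ｛ a ｝ ⊙ (b · c)
    identity : ∃! _≡_ λ e → ∀ a → e · a ≐ ｛ a ｝ × ｛ a ｝ ≐ a · e
    exchange₁ : ∀ a b c → a ∈ b · c ⇔ b ∈ a · (c ⋆)
    exchange₂ : ∀ a b c → b ∈ a · (c ⋆) ⇔ c ∈ (b ⋆) · a
    exchange₃ : ∀ a b c → a ∈ b · c ⇔ c ∈ (b ⋆) · a

  e : Carrier
  e = proj₁ identity

  _⋆ˢ : Pred Carrier ℓ₁ → Pred Carrier (ℓ ⊔ ℓ₁)
  (G ⋆ˢ) x = ∃ λ a → a ∈ G × x ≡ a ⋆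

  IsClosed : Pred Carrier ℓ₁ → Set (ℓ ⊔ ℓ₁)
  IsClosed G = Satisfiable G × (G ⋆ˢ ⊙ G ⊆ G)

  ⟨_⟩ : Pred Carrier ℓ₁ → Pred Carrier (lsuc ℓ ⊔ ℓ₁)
  ⟨ G ⟩ x = (F : Pred Carrier ℓ) → IsClosed F → G ⊆ F → x ∈ F

  IsThin IsThick : Pred Carrier ℓ
  IsThin  a = (a ⋆) · a ≐ ｛ e ｝
  IsThick a = ¬ IsThin a

  -- O_ϑ(G)
  thinRadical : Pred Carrier ℓ₁ → Pred Carrier (ℓ ⊔ ℓ₁)
  thinRadical G = G ∩ IsThin

  IsNormalIn : Pred Carrier ℓ₁ → Pred Carrier ℓ₂ → Set (ℓ ⊔ ℓ₁ ⊔ ℓ₂)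
  IsNormalIn F G = F ⊆ G × (∀ a → a ∈ G → F ⊙ ｛ a ｝ ≐ ｛ a ｝ ⊙ F)

  IsStronglyNormalIn : Pred Carrier ℓ₁ → Pred Carrier ℓ₂ → Set (ℓ ⊔ ℓ₁ ⊔ ℓ₂)
  IsStronglyNormalIn F G = (∀ a → a ∈ G → (｛ a ⋆ ｝ ⊙ F) ⊙ ｛ a ｝ ⊆ F) × F ⊆ G

  -- O^ϑ(G)
  thinResidue : Pred Carrier ℓ₁ → Pred Carrier (lsuc ℓ ⊔ ℓ₁)
  thinResidue G x =
    (F : Pred Carrier ℓ) → IsClosed F → IsStronglyNormalIn F ⟨ G ⟩ → x ∈ F

  IsInvolution : Pred Carrier ℓ
  IsInvolution a = a ≢ e × IsClosed (｛ e ｝ ∪ ｛ a ｝)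

  -- Gᵞ = { {a} : a ∈ G }
  infix 8 _ᵞ
  _ᵞ : Pred Carrier ℓ₁ → Pred (Pred Carrier ℓ) (ℓ ⊔ ℓ₁)
  (G ᵞ) X = ∃ λ a → a ∈ G × X ≐ ｛ a ｝

  ∏ : ∀ {n} → (Fin n → Pred Carrier ℓ₁) → Pred Carrier (ℓ ⊔ ℓ₁)
  ∏ {ℓ₁} {zero}  G = λ x → Lift ℓ₁ (x ∈ ｛ e ｝)
  ∏ {ℓ₁} {suc n} G = G zero ⊙ ∏ (G ∘ suc)

  ∏ₑ : ∀ {n} → (Fin n → Carrier) → Pred Carrier ℓ
  ∏ₑ r = ∏ (λ i → ｛ r i ｝)

  record IsDirectProduct {m} (G : Fin (suc m) → Pred Carrier ℓ₁) : Set (ℓ ⊔ ℓ₁) where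
    field
      closed   : ∀ i → IsClosed (G i)
      normal   : ∀ i → IsNormalIn (G i) U
      spanning : ∀ i → G i ⊙ ∏ (removeAt G i) ≐ U
      disjoint : ∀ i → G i ∩ ∏ (removeAt G i) ≐ ｛ e ｝

  -- For a direct product each a lies in ∏ₑ r for exactly one r with r i ∈ G i,
  -- so quantifying over all such r speaks of that unique factorisation.
  IsConstrained : ∀ {m} → (Fin (suc m) → Pred Carrier ℓ₁) → Set (ℓ ⊔ ℓ₁)
  IsConstrained G =
    ∀ a r → (∀ i → r i ∈ G i) → a ∈ ∏ₑ r → ∏ₑ r ≐ ｛ a ｝

  ⊙-mono : {F : Pred Carrier ℓ₁} {F′ : Pred Carrier ℓ₂}
           {G : Pred Carrier ℓ₃} {G′ : Pred Carrier ℓ₄} →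
           F ⊆ F′ → G ⊆ G′ → F ⊙ G ⊆ F′ ⊙ G′
  ⊙-mono f g (b , c , b∈ , c∈ , x∈) = b , c , f b∈ , g c∈ , x∈

  ⊙-assocˡ : {F : Pred Carrier ℓ₁} {G : Pred Carrier ℓ₂} {K : Pred Carrier ℓ₃} →
             (F ⊙ G) ⊙ K ⊆ F ⊙ (G ⊙ K)
  ⊙-assocˡ (b , c , (f , g , f∈ , g∈ , b∈fg) , c∈ , x∈bc)
    with proj₁ (assoc f g c) (b , c , b∈fg , refl , x∈bc)
  ... | _ , y , refl , y∈gc , x∈fy = f , y , f∈ , (g , c , g∈ , c∈ , y∈gc) , x∈fy

  ⊙-assocʳ : {F : Pred Carrier ℓ₁} {G : Pred Carrier ℓ₂} {K : Pred Carrier ℓ₃} →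
             F ⊙ (G ⊙ K) ⊆ (F ⊙ G) ⊙ K
  ⊙-assocʳ (f , y , f∈ , (g , c , g∈ , c∈ , y∈gc) , x∈fy)
    with proj₂ (assoc f g c) (f , y , refl , y∈gc , x∈fy)
  ... | b , _ , b∈fg , refl , x∈bc = b , c , (f , g , f∈ , g∈ , b∈fg) , c∈ , x∈bc

  e·a⊆a : ∀ {a x} → x ∈ e · a → a ≡ x
  e·a⊆a {a} = proj₁ (proj₁ (proj₁ (proj₂ identity) a))

  a·e⊆a : ∀ {a x} → x ∈ a · e → a ≡ x
  a·e⊆a {a} = proj₂ (proj₂ (proj₁ (proj₂ identity) a))

  a∈e·a : ∀ a → a ∈ e · a
  a∈e·a a = proj₂ (proj₁ (proj₁ (proj₂ identity) a)) refl

  a∈a·e : ∀ a → a ∈ a · e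
  a∈a·e a = proj₁ (proj₂ (proj₁ (proj₂ identity) a)) refl

  e∈a⋆·a : ∀ a → e ∈ (a ⋆) · a
  e∈a⋆·a a = Equivalence.to (exchange₃ a a e) (a∈a·e a)

  ⋆-involutive : ∀ a → (a ⋆) ⋆ ≡ a
  ⋆-involutive a = a·e⊆a (Equivalence.to (exchange₃ e (a ⋆) a) (e∈a⋆·a a))

  e⋆≡e : e ⋆ ≡ e
  e⋆≡e = a·e⊆a (e∈a⋆·a e)

  ⋆-antidistrib : ∀ {x a b} → x ∈ a · b → x ⋆ ∈ (b ⋆) · (a ⋆)
  ⋆-antidistrib {x} {a} {b} x∈ =
    Equivalence.to (exchange₃ (a ⋆) b (x ⋆))
      (Equivalence.to (exchange₁ b (a ⋆) x) (Equivalence.to (exchange₃ x a b) x∈))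

  ·-nonempty : ∀ a b → Satisfiable (a · b)
  ·-nonempty a b
    with ⊙-assocˡ {F = ｛ a ⋆ ｝} {G = ｛ a ｝} {K = ｛ b ｝}
           (e , b , (a ⋆ , a , refl , refl , e∈a⋆·a a) , refl , a∈e·a b)
  ... | _ , y , refl , (_ , _ , refl , refl , y∈a·b) , _ = y , y∈a·b

  private
    thin-quotient : ∀ {a b c d x} → IsThin a → IsThin b →
                    c ∈ a · b → d ∈ a · b → x ∈ (c ⋆) · d → e ≡ x
    thin-quotient {a} {b} ta tb c∈ d∈ x∈
      with ⊙-assocˡ {F = ｛ b ⋆ ｝} {G = ｛ a ⋆ ｝} {K = ｛ a ｝ ⊙ ｛ b ｝}
             (_ , _ , (_ , _ , refl , refl , ⋆-antidistrib c∈) , (_ , _ , refl , refl , d∈) , x∈)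
    ... | _ , y , refl , y∈ , x∈b⋆y
      with ⊙-assocʳ {F = ｛ a ⋆ ｝} {G = ｛ a ｝} {K = ｛ b ｝} y∈
    ... | z , _ , (_ , _ , refl , refl , z∈) , refl , y∈zb
      with refl ← proj₁ ta z∈ with refl ← e·a⊆a y∈zb = proj₁ tb x∈b⋆y

  thin-·-singleton : ∀ {a b} → IsThin a → IsThin b →
                     ∃ λ c → IsThin c × (｛ a ｝ ⊙ ｛ b ｝ ≐ ｛ c ｝)
  thin-·-singleton {a} {b} ta tb = c , thin-c , ab⊆c , λ { refl → a , b , refl , refl , c∈ }
    where
    c = proj₁ (·-nonempty a b)
    c∈ = proj₂ (·-nonempty a b)

    thin-c : IsThin c
    thin-c = thin-quotient ta tb c∈ c∈ , λ { refl → e∈a⋆·a c }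

    ab⊆c : ｛ a ｝ ⊙ ｛ b ｝ ⊆ ｛ c ｝
    ab⊆c {x} (_ , _ , refl , refl , x∈) =
      let y , y∈ = ·-nonempty (c ⋆) x
          e∈     = subst (_∈ (c ⋆) · x) (sym (thin-quotient ta tb c∈ x∈ y∈)) y∈
      in a·e⊆a (Equivalence.from (exchange₃ x c e) e∈)

  e-thin : IsThin e
  e-thin = (λ {x} x∈ → e·a⊆a (subst (λ y → x ∈ y · e) e⋆≡e x∈)) , λ { refl → e∈a⋆·a e }

record IsSubgroup {c ℓ} (𝓖 : Group c ℓ) (P : Pred (Group.Carrier 𝓖) ℓ₁) : Set (c ⊔ ℓ₁) where
  open Group 𝓖 using (ε; _∙_; _⁻¹)
  field
    ε-closed  : ε ∈ P
    ∙-closed  : ∀ {x y} → x ∈ P → y ∈ P → x ∙ y ∈ P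
    ⁻¹-closed : ∀ {x} → x ∈ P → x ⁻¹ ∈ P

record ElementaryAbelian2 (𝓗 : Hypergroup ℓ) : Set (lsuc ℓ) where
  open Hypergroup 𝓗

  -- The number p ≥ 1 of factors is suc m.
  field
    {m}           : ℕ
    q             : Fin (suc m) → Carrier
    involution    : ∀ i → IsInvolution (q i)
    directProduct : IsDirectProduct (λ i → ⟨ ｛ q i ｝ ⟩)
    constrained   : IsConstrained (λ i → ⟨ ｛ q i ｝ ⟩)

  -- The set {r₁, …, r_p} ∖ {e}, where r is the factorisation of a.
  support : Carrier → Pred Carrier (lsuc ℓ)
  support a x = ∃ λ (r : Fin (suc m) → Carrier) →
    (∀ i → r i ∈ ⟨ ｛ q i ｝ ⟩) × a ∈ ∏ₑ r × (∃ λ i → x ≡ r i) × x ≢ e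

  Thick : Pred Carrier ℓ₁ → Pred Carrier (lsuc ℓ ⊔ ℓ₁)
  Thick F a = a ∈ F × (a ≡ e ⊎ support a ⊆ IsThick)

  private
    ⟨q⟩⊆ : ∀ {i t} → t ∈ ⟨ ｛ q i ｝ ⟩ → t ∈ ｛ e ｝ ∪ ｛ q i ｝
    ⟨q⟩⊆ {i} t∈ = t∈ _ (proj₂ (involution i)) inj₂

    q∈⟨q⟩ : ∀ i → q i ∈ ⟨ ｛ q i ｝ ⟩
    q∈⟨q⟩ i F _ q⊆F = q⊆F refl

    q⋆≡q : ∀ i → q i ⋆ ≡ q i
    q⋆≡q i with proj₂ (proj₂ (involution i))
                  (q i ⋆ , e , (q i , inj₂ refl , refl) , inj₁ refl , a∈a·e (q i ⋆))
    ... | inj₂ q≡q⋆ = sym q≡q⋆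
    ... | inj₁ e≡q⋆ = contradiction
      (trans (sym (⋆-involutive (q i))) (trans (cong _⋆ (sym e≡q⋆)) e⋆≡e))
      (proj₁ (involution i))

    q·q⊆ : ∀ i → q i · q i ⊆ ｛ e ｝ ∪ ｛ q i ｝
    q·q⊆ i x∈ = proj₂ (proj₂ (involution i))
      (q i , q i , (q i , inj₂ refl , sym (q⋆≡q i)) , inj₂ refl , x∈)

    q-comm : ∀ i j → q i · q j ⊆ q j · q i
    q-comm i j x∈
      with proj₁ (proj₂ (IsDirectProduct.normal directProduct i) (q j) _)
             (q i , q j , q∈⟨q⟩ i , refl , x∈)
    ... | _ , t , refl , t∈ , x∈qt with ⟨q⟩⊆ t∈
    ... | inj₂ refl = x∈qt
    ... | inj₁ refl with refl ← a·e⊆a x∈qt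
      with q·q⊆ j (subst (λ y → q i ∈ q j · y) (q⋆≡q j)
             (Equivalence.to (exchange₁ (q j) (q i) (q j)) x∈))
    ... | inj₁ e≡qi = contradiction (sym e≡qi) (proj₁ (involution i))
    ... | inj₂ qj≡qi = subst (λ y → q j ∈ q j · y) qj≡qi
                         (subst (λ y → q j ∈ y · q j) (sym qj≡qi) x∈)

    ⟨q⟩-comm : ∀ {i j s t} → s ∈ ⟨ ｛ q i ｝ ⟩ → t ∈ ⟨ ｛ q j ｝ ⟩ → s · t ⊆ t · s
    ⟨q⟩-comm {i} {j} {s} {t} s∈ t∈ {x} x∈ with ⟨q⟩⊆ s∈ | ⟨q⟩⊆ t∈
    ... | inj₂ refl | inj₂ refl = q-comm i j x∈
    ... | inj₁ refl | _         = subst (_∈ t · e) (e·a⊆a x∈) (a∈a·e t)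
    ... | _         | inj₁ refl = subst (_∈ e · s) (a·e⊆a x∈) (a∈e·a s)

    ⟨q⟩-⋆ : ∀ {i t} → t ∈ ⟨ ｛ q i ｝ ⟩ → t ⋆ ≡ t
    ⟨q⟩-⋆ {i} t∈ with ⟨q⟩⊆ t∈
    ... | inj₁ refl = e⋆≡e
    ... | inj₂ refl = q⋆≡q i

    ∏-comm : ∀ {n s} (r : Fin n → Carrier) → (∀ i → r i · s ⊆ s · r i) →
             ∏ₑ r ⊙ ｛ s ｝ ⊆ ｛ s ｝ ⊙ ∏ₑ r
    ∏-comm {zero} {s} r comm (_ , _ , lift refl , refl , x∈) with refl ← e·a⊆a x∈ =
      s , e , refl , lift refl , a∈a·e s
    ∏-comm {suc n} {s} r comm x∈ with ⊙-assocˡ {F = ｛ r zero ｝} {K = ｛ s ｝} x∈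
    ... | _ , y , refl , y∈ , x∈ry
      with ⊙-assocʳ {F = ｛ r zero ｝} {G = ｛ s ｝} {K = ∏ₑ (r ∘ suc)}
             (_ , y , refl , ∏-comm (r ∘ suc) (comm ∘ suc) y∈ , x∈ry)
    ... | u , v , (_ , _ , refl , refl , u∈) , v∈ , x∈uv =
      ⊙-assocˡ {F = ｛ s ｝} {G = ｛ r zero ｝} {K = ∏ₑ (r ∘ suc)}
        (u , v , (s , r zero , refl , refl , comm zero u∈) , v∈ , x∈uv)

    ∏-⋆ : ∀ {n x} (r : Fin n → Carrier) → (∀ i → r i ⋆ ≡ r i) →
          (∀ i j → r i · r j ⊆ r j · r i) → x ∈ ∏ₑ r → x ⋆ ∈ ∏ₑ r
    ∏-⋆ {zero} r inv comm (lift refl) = lift (sym e⋆≡e)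
    ∏-⋆ {suc n} {x} r inv comm (_ , y , refl , y∈ , x∈ry) =
      ∏-comm (r ∘ suc) (λ i → comm (suc i) zero)
        ( y ⋆ , r zero
        , ∏-⋆ (r ∘ suc) (inv ∘ suc) (λ i j → comm (suc i) (suc j)) y∈ , refl
        , subst (λ z → x ⋆ ∈ (y ⋆) · z) (inv zero) (⋆-antidistrib x∈ry))

    factorisation : ∀ {n} (G : Fin n → Pred Carrier ℓ₁) {a} → a ∈ ∏ G →
                    ∃ λ r → (∀ i → r i ∈ G i) × a ∈ ∏ₑ r
    factorisation {n = zero}  G (lift refl) = (λ ()) , (λ ()) , lift refl
    factorisation {n = suc _} G (b , c , b∈ , c∈ , a∈) =
      let r , r∈ , c∈r = factorisation (G ∘ suc) c∈ in
        (λ { zero → b ; (suc i) → r i })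
      , (λ { zero → b∈ ; (suc i) → r∈ i })
      , (b , c , refl , c∈r , a∈)

  a⋆≡a : ∀ a → a ⋆ ≡ a
  a⋆≡a a with proj₂ (IsDirectProduct.spanning directProduct zero) {a} _
  ... | a∈ with factorisation (λ i → ⟨ ｛ q i ｝ ⟩) a∈
  ... | r , r∈ , a∈r = sym (proj₁ (constrained a r r∈ a∈r)
    (∏-⋆ r (λ i → ⟨q⟩-⋆ (r∈ i)) (λ i j → ⟨q⟩-comm (r∈ i) (r∈ j)) a∈r))

  ·-comm : ∀ a b → a · b ⊆ b · a
  ·-comm a b {x} x∈ = subst (_∈ b · a) (a⋆≡a x)
    (subst (λ y → x ⋆ ∈ y · a) (a⋆≡a b)
      (subst (λ y → x ⋆ ∈ (b ⋆) · y) (a⋆≡a a) (⋆-antidistrib x∈)))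

  -- The elementary abelian 2-group O_ϑ(𝓗)ᵞ: its elements are the subsets
  -- {a} with a thin, and its operation is the product of subsets.

  private
    ᵞ-∙ : ∀ {X Y : Pred Carrier ℓ} → X ∈ thinRadical U ᵞ → Y ∈ thinRadical U ᵞ →
          X ⊙ Y ∈ thinRadical U ᵞ
    ᵞ-∙ (a , (_ , ta) , X⊆ , ⊆X) (b , (_ , tb) , Y⊆ , ⊆Y) =
      let c , tc , ab⊆ , ⊆ab = thin-·-singleton ta tb in
      c , (_ , tc) , (λ x∈ → ab⊆ (⊙-mono X⊆ Y⊆ x∈)) , (λ x∈ → ⊙-mono ⊆X ⊆Y (⊆ab x∈))

    ⋆ˢ-id : ∀ (X : Pred Carrier ℓ) → X ⋆ˢ ≐ X
    ⋆ˢ-id X = (λ { (a , a∈ , refl) → subst (_∈ X) (sym (a⋆≡a a)) a∈ })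
            , (λ {a} a∈ → a , a∈ , sym (a⋆≡a a))

    ᵞ-⁻¹ : ∀ {X : Pred Carrier ℓ} → X ∈ thinRadical U ᵞ → X ⋆ˢ ∈ thinRadical U ᵞ
    ᵞ-⁻¹ {X} (a , ta , X⊆ , ⊆X) =
      a , ta , (λ x∈ → X⊆ (proj₁ (⋆ˢ-id X) x∈)) , (λ x∈ → proj₂ (⋆ˢ-id X) (⊆X x∈))

    ⊙-comm : ∀ (X Y : Pred Carrier ℓ) → X ⊙ Y ⊆ Y ⊙ X
    ⊙-comm X Y (b , c , b∈ , c∈ , x∈) = c , b , c∈ , b∈ , ·-comm b c x∈

    ⊙-identityˡ : ∀ (X : Pred Carrier ℓ) → ｛ e ｝ ⊙ X ≐ X
    ⊙-identityˡ X = (λ { (_ , c , refl , c∈ , x∈) → subst (_∈ X) (e·a⊆a x∈) c∈ })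
                  , (λ {x} x∈ → e , x , refl , x∈ , a∈e·a x)

    ⊙-inverseˡ : ∀ {X : Pred Carrier ℓ} → X ∈ thinRadical U ᵞ → X ⋆ˢ ⊙ X ≐ ｛ e ｝
    ⊙-inverseˡ {X} (a , (_ , ta) , X⊆ , ⊆X) = to , λ { refl →
        a ⋆ , a , (a , ⊆X refl , refl) , ⊆X refl , proj₂ ta refl }
      where
      to : X ⋆ˢ ⊙ X ⊆ ｛ e ｝
      to (_ , c , (b , b∈ , refl) , c∈ , x∈) with refl ← X⊆ b∈ | refl ← X⊆ c∈ = proj₁ ta x∈

  thinGroup : AbelianGroup (lsuc ℓ) ℓ
  thinGroup = record
    { Carrier = Σ (Pred Carrier ℓ) (_∈ thinRadical U ᵞ)
    ; _≈_     = λ X Y → proj₁ X ≐ proj₁ Y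
    ; _∙_     = λ X Y → proj₁ X ⊙ proj₁ Y , ᵞ-∙ (proj₂ X) (proj₂ Y)
    ; ε       = ｛ e ｝ , e , (_ , e-thin) , (λ x∈ → x∈) , (λ x∈ → x∈)
    ; _⁻¹     = λ X → proj₁ X ⋆ˢ , ᵞ-⁻¹ (proj₂ X)
    ; isAbelianGroup = record
      { isGroup = record
        { isMonoid = record
          { isSemigroup = record
            { isMagma = record
              { isEquivalence = record
                { refl  = (λ x∈ → x∈) , (λ x∈ → x∈)
                ; sym   = λ (f , g) → g , f
                ; trans = λ (f , g) (h , k) → (λ x∈ → h (f x∈)) , (λ x∈ → g (k x∈))
                }
              ; ∙-cong = λ (f , g) (h , k) → ⊙-mono f h , ⊙-mono g k
              }
            ; assoc = λ X Y Z → ⊙-assocˡ {F = proj₁ X} {proj₁ Y} {proj₁ Z}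
                              , ⊙-assocʳ {F = proj₁ X} {proj₁ Y} {proj₁ Z}
            }
          ; identity = (λ X → ⊙-identityˡ (proj₁ X))
                     , (λ X → (λ x∈ → proj₁ (⊙-identityˡ (proj₁ X)) (⊙-comm (proj₁ X) ｛ e ｝ x∈))
                            , (λ x∈ → ⊙-comm ｛ e ｝ (proj₁ X) (proj₂ (⊙-identityˡ (proj₁ X)) x∈)))
          }
        ; inverse = (λ X → ⊙-inverseˡ (proj₂ X))
                  , (λ X → (λ x∈ → proj₁ (⊙-inverseˡ (proj₂ X)) (⊙-comm (proj₁ X) (proj₁ X ⋆ˢ) x∈))
                         , (λ x∈ → ⊙-comm (proj₁ X ⋆ˢ) (proj₁ X) (proj₂ (⊙-inverseˡ (proj₂ X)) x∈)))
        ; ⁻¹-cong = λ (f , g) → (λ (a , a∈ , eq) → a , f a∈ , eq)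
                              , (λ (a , a∈ , eq) → a , g a∈ , eq)
        }
      ; comm = λ X Y → ⊙-comm (proj₁ X) (proj₁ Y) , ⊙-comm (proj₁ Y) (proj₁ X)
      }
    }

  private module T = AbelianGroup thinGroup

  thinGroup-exponent-2 : ∀ X → (X T.∙ X) T.≈ T.ε
  thinGroup-exponent-2 X =
    T.trans {X T.∙ X} {(X T.⁻¹) T.∙ X} {T.ε}
      (T.∙-cong {X} {X T.⁻¹} {X} {X} (T.sym {X T.⁻¹} {X} (⋆ˢ-id (proj₁ X))) (T.refl {X}))
      (T.inverseˡ X)

  ᵞ-IsSubgroup : Pred Carrier ℓ → Set (lsuc ℓ)
  ᵞ-IsSubgroup F =
    F ᵞ ⊆ thinRadical U ᵞ × IsSubgroup T.group (λ X → proj₁ X ∈ F ᵞ)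

{-# OPTIONS --safe #-}
-- Every element is a product of elements s i ∈ {e, q i}, and by commutativity
-- products are computed factor by factor: (∏ s)(∏ t) = ∏ (s i · t i).  Hence a·a
-- is a closed subset, consisting of the products of thick q i occurring in a.
-- For closed G let r be the product of the thick q i in G.  Then r·r = ⟨ r ⟩
-- contains a·a for all a ∈ G, so it is the least strongly normal closed subset,
-- and each a ∈ G splits as (thick part)(thin part) with thick part in a·a.
module Submission where

open import Defs
open import Level using (Level; lift) renaming (suc to lsuc)
open import Axiom.ExcludedMiddle using (ExcludedMiddle)
open import Data.Fin.Base using (Fin; zero; suc; punchIn)
open import Data.Nat.Base using (zero; suc)
open import Data.Product.Base using (∃; _×_; _,_; proj₁; proj₂)
open import Data.Sum.Base using (inj₁; inj₂; [_,_])
open import Data.Vec.Functional using (removeAt)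
open import Function.Base using (_∘_)
open import Function.Bundles using (_⇔_; mk⇔; Equivalence)
open import Relation.Binary.PropositionalEquality
  using (_≡_; _≢_; refl; sym; trans; subst; subst₂)
open import Relation.Nullary using (yes; no; contradiction)
open import Relation.Unary using (Pred; _∈_; _⊆_; _≐_; _∩_; _∪_; ｛_｝; U; Satisfiable)

private
  variable
    ℓ ℓ₁ ℓ₂ ℓ₃ ℓ₄ : Level

-- Closed subsets and iterated products in an arbitrary hypergroup.

module HypergroupProperties (𝓗 : Hypergroup ℓ) where
  open Hypergroup 𝓗

  e∈closed : {F : Pred Carrier ℓ₁} → IsClosed F → e ∈ F
  e∈closed ((a , a∈) , ⋆⊙⊆) = ⋆⊙⊆ (a ⋆ , a , (a , a∈ , refl) , a∈ , e∈a⋆·a a)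

  ⟨⟩-closed : (F : Pred Carrier ℓ₁) → IsClosed ⟨ F ⟩
  ⟨⟩-closed F = (e , λ K K-closed _ → e∈closed K-closed)
    , λ { (_ , c , (b , b∈ , refl) , c∈ , x∈) K K-closed F⊆K →
          proj₂ K-closed (_ , c , (b , b∈ K K-closed F⊆K , refl) , c∈ K K-closed F⊆K , x∈) }

  ⊆⟨⟩ : (F : Pred Carrier ℓ₁) → F ⊆ ⟨ F ⟩
  ⊆⟨⟩ F x∈ K K-closed F⊆K = F⊆K x∈

  factorisation : ∀ {n} (S : Fin n → Pred Carrier ℓ₁) {a} → a ∈ ∏ S →
                  ∃ λ s → (∀ i → s i ∈ S i) × a ∈ ∏ₑ s
  factorisation {n = zero}  S (lift refl) = (λ ()) , (λ ()) , lift refl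
  factorisation {n = suc _} S (b , c , b∈ , c∈ , a∈) =
    let s , s∈ , c∈s = factorisation (S ∘ suc) c∈ in
      (λ { zero → b ; (suc i) → s i })
    , (λ { zero → b∈ ; (suc i) → s∈ i })
    , (b , c , refl , c∈s , a∈)

  ∏-mono : ∀ {n} (S : Fin n → Pred Carrier ℓ₁) (T : Fin n → Pred Carrier ℓ₂) →
           (∀ i → S i ⊆ T i) → ∏ S ⊆ ∏ T
  ∏-mono {n = zero}  S T S⊆T (lift refl) = lift refl
  ∏-mono {n = suc _} S T S⊆T (b , c , b∈ , c∈ , x∈) =
    b , c , S⊆T zero b∈ , ∏-mono (S ∘ suc) (T ∘ suc) (S⊆T ∘ suc) c∈ , x∈

  ∏ₑ⊆∏ : ∀ {n} (S : Fin n → Pred Carrier ℓ₁) {s} → (∀ i → s i ∈ S i) → ∏ₑ s ⊆ ∏ S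
  ∏ₑ⊆∏ S {s} s∈ = ∏-mono (λ i → ｛ s i ｝) S (λ i eq → subst (_∈ S i) eq (s∈ i))

  ∏ₑ-nonempty : ∀ {n} (s : Fin n → Carrier) → Satisfiable (∏ₑ s)
  ∏ₑ-nonempty {zero}  s = e , lift refl
  ∏ₑ-nonempty {suc n} s =
    let c , c∈ = ∏ₑ-nonempty (s ∘ suc)
        x , x∈ = ·-nonempty (s zero) c
    in x , s zero , c , refl , c∈ , x∈

  ∏⊆｛e｝ : ∀ {n} (S : Fin n → Pred Carrier ℓ₁) → (∀ i → S i ⊆ ｛ e ｝) → ∏ S ⊆ ｛ e ｝
  ∏⊆｛e｝ {n = zero}  S S⊆ (lift refl) = refl
  ∏⊆｛e｝ {n = suc _} S S⊆ (b , c , b∈ , c∈ , x∈)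
    with refl ← S⊆ zero b∈ | refl ← ∏⊆｛e｝ (S ∘ suc) (S⊆ ∘ suc) c∈ = e·a⊆a x∈

  e∈∏ : ∀ {n} (S : Fin n → Pred Carrier ℓ₁) → (∀ i → e ∈ S i) → e ∈ ∏ S
  e∈∏ {n = zero}  S e∈ = lift refl
  e∈∏ {n = suc _} S e∈ = e , e , e∈ zero , e∈∏ (S ∘ suc) (e∈ ∘ suc) , a∈e·a e

  factor⊆∏ : ∀ {n} (S : Fin n → Pred Carrier ℓ₁) → (∀ i → e ∈ S i) → ∀ i → S i ⊆ ∏ S
  factor⊆∏ S e∈ zero    {x} x∈ = x , e , x∈ , e∈∏ (S ∘ suc) (e∈ ∘ suc) , a∈a·e x
  factor⊆∏ S e∈ (suc i) {x} x∈ =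
    e , x , e∈ zero , factor⊆∏ (S ∘ suc) (e∈ ∘ suc) i x∈ , a∈e·a x

module ElementaryAbelian2Properties {𝓗 : Hypergroup ℓ} (E : ElementaryAbelian2 𝓗) where
  open Hypergroup 𝓗
  open ElementaryAbelian2 E
  open HypergroupProperties 𝓗

  -- Consequences of `a ⋆ ≡ a` and of commutativity.

  ·-closed : {F : Pred Carrier ℓ₁} → IsClosed F → ∀ {b c} → b ∈ F → c ∈ F → b · c ⊆ F
  ·-closed (_ , ⋆⊙⊆) {b} {c} b∈ c∈ x∈ = ⋆⊙⊆ (b , c , (b , b∈ , sym (a⋆≡a b)) , c∈ , x∈)

  ·-closed⇒closed : {F : Pred Carrier ℓ₁} → e ∈ F → F ⊙ F ⊆ F → IsClosed F
  ·-closed⇒closed {F = F} e∈ ⊙⊆ = (e , e∈) , λ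
    { (_ , c , (b , b∈ , refl) , c∈ , x∈) →
      ⊙⊆ (_ , c , subst (_∈ F) (sym (a⋆≡a b)) b∈ , c∈ , x∈) }

  ∏ₑ⊆closed : {F : Pred Carrier ℓ₁} → IsClosed F →
              ∀ {n} {s : Fin n → Carrier} → (∀ i → s i ∈ F) → ∏ₑ s ⊆ F
  ∏ₑ⊆closed F-closed {zero}  s∈ (lift refl) = e∈closed F-closed
  ∏ₑ⊆closed F-closed {suc n} s∈ (_ , c , refl , c∈ , x∈) =
    ·-closed F-closed (s∈ zero) (∏ₑ⊆closed F-closed (s∈ ∘ suc) c∈) x∈

  e∈a·a : ∀ a → e ∈ a · a
  e∈a·a a = subst (λ b → e ∈ b · a) (a⋆≡a a) (e∈a⋆·a a)

  -- Exchange turns `e ∈ a · b` into `a ∈ e · b ⋆`, and `b ⋆` is `b`.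
  e∈a·b⇒a≡b : ∀ {a b} → e ∈ a · b → a ≡ b
  e∈a·b⇒a≡b {a} {b} e∈ =
    trans (sym (e·a⊆a (Equivalence.to (exchange₁ e a b) e∈))) (a⋆≡a b)

  thin⇒a·a⊆｛e｝ : ∀ {a} → IsThin a → a · a ⊆ ｛ e ｝
  thin⇒a·a⊆｛e｝ {a} thin {x} x∈ = proj₁ thin (subst (λ b → x ∈ b · a) (sym (a⋆≡a a)) x∈)

  a·a⊆｛e｝⇒thin : ∀ {a} → a · a ⊆ ｛ e ｝ → IsThin a
  a·a⊆｛e｝⇒thin {a} a·a⊆ =
      (λ {x} x∈ → a·a⊆ (subst (λ b → x ∈ b · a) (a⋆≡a a) x∈))
    , λ { refl → e∈a⋆·a a }

  ⊙-comm : (F : Pred Carrier ℓ₁) (G : Pred Carrier ℓ₂) → F ⊙ G ⊆ G ⊙ F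
  ⊙-comm F G (b , c , b∈ , c∈ , x∈) = c , b , c∈ , b∈ , ·-comm b c x∈

  ⊙-interchange : (A : Pred Carrier ℓ₁) (B : Pred Carrier ℓ₂)
                  (C : Pred Carrier ℓ₃) (D : Pred Carrier ℓ₄) →
                  (A ⊙ B) ⊙ (C ⊙ D) ⊆ (A ⊙ C) ⊙ (B ⊙ D)
  ⊙-interchange A B C D x∈ with ⊙-assocˡ {F = A} {B} {C ⊙ D} x∈
  ... | a , y , a∈ , y∈ , x∈ay = ⊙-assocʳ {F = A} {C} {B ⊙ D}
    ( a , y , a∈
    , ⊙-assocˡ {F = C} {B} {D}
        (⊙-mono (⊙-comm B C) (λ d∈ → d∈) (⊙-assocʳ {F = B} {C} {D} y∈))
    , x∈ay )

  ∏-⊙-∏ : ∀ {n} (S : Fin n → Pred Carrier ℓ₁) (T : Fin n → Pred Carrier ℓ₂) →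
          ∏ S ⊙ ∏ T ≐ ∏ (λ i → S i ⊙ T i)
  ∏-⊙-∏ {n = zero} S T =
      (λ { (_ , _ , lift refl , lift refl , x∈) → lift (e·a⊆a x∈) })
    , (λ { (lift refl) → e , e , lift refl , lift refl , a∈e·a e })
  ∏-⊙-∏ {n = suc _} S T =
      (λ x∈ → ⊙-mono (λ y∈ → y∈) (proj₁ (∏-⊙-∏ (S ∘ suc) (T ∘ suc)))
                (⊙-interchange (S zero) (∏ (S ∘ suc)) (T zero) (∏ (T ∘ suc)) x∈))
    , (λ x∈ → ⊙-interchange (S zero) (T zero) (∏ (S ∘ suc)) (∏ (T ∘ suc))
                (⊙-mono (λ y∈ → y∈) (proj₂ (∏-⊙-∏ (S ∘ suc) (T ∘ suc))) x∈))

  -- Commutativity moves factor `i` past the earlier ones to the front, which gives the form that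
  -- `disjoint` speaks about.
  ∏-removeAt : ∀ {n} (S : Fin (suc n) → Pred Carrier ℓ₁) i → ∏ S ⊆ S i ⊙ ∏ (removeAt S i)
  ∏-removeAt S zero x∈ = x∈
  ∏-removeAt {n = suc _} S (suc i) (b , c , b∈ , c∈ , x∈)
    with ⊙-assocʳ {F = S zero} {S (suc i)} {∏ (removeAt (S ∘ suc) i)}
           (b , c , b∈ , ∏-removeAt (S ∘ suc) i c∈ , x∈)
  ... | y , z , y∈ , z∈ , x∈yz =
    ⊙-assocˡ {F = S (suc i)} {S zero} {∏ (removeAt (S ∘ suc) i)}
      (y , z , ⊙-comm (S zero) (S (suc i)) y∈ , z∈ , x∈yz)

  -- Coordinates with respect to the involutions.

  Q : Fin (suc m) → Pred Carrier (lsuc ℓ)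
  Q i = ⟨ ｛ q i ｝ ⟩

  -- As `q i` is an involution, `｛ e ｝ ∪ ｛ q i ｝` is one of the closed subsets intersected in `Q i`.
  Q⊆ : ∀ {i} → Q i ⊆ ｛ e ｝ ∪ ｛ q i ｝
  Q⊆ {i} x∈ = x∈ _ (proj₂ (involution i)) inj₂

  e∈Q : ∀ i → e ∈ Q i
  e∈Q i = e∈closed (⟨⟩-closed ｛ q i ｝)

  q∈Q : ∀ i → q i ∈ Q i
  q∈Q i = ⊆⟨⟩ ｛ q i ｝ refl

  Q-·-closed : ∀ {i a b} → a ∈ Q i → b ∈ Q i → a · b ⊆ Q i
  Q-·-closed {i} = ·-closed (⟨⟩-closed ｛ q i ｝)

  coordinates : ∀ a → ∃ λ s → (∀ i → s i ∈ Q i) × a ∈ ∏ₑ s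
  coordinates a = factorisation Q (proj₂ (IsDirectProduct.spanning directProduct zero) {a} _)

  ·-coordinates : ∀ s t {a b} → (∀ i → s i ∈ Q i) → (∀ i → t i ∈ Q i) →
                  a ∈ ∏ₑ s → b ∈ ∏ₑ t → a · b ≐ ∏ (λ i → s i · t i)
  ·-coordinates s t {a} {b} s∈ t∈ a∈ b∈ = to , from
    where
    S = λ i → ｛ s i ｝
    T = λ i → ｛ t i ｝

    to : a · b ⊆ ∏ (λ i → s i · t i)
    to x∈ = ∏-mono (λ i → S i ⊙ T i) (λ i → s i · t i) (λ { i (_ , _ , refl , refl , y∈) → y∈ })
      (proj₁ (∏-⊙-∏ S T) (a , b , a∈ , b∈ , x∈))

    from : ∏ (λ i → s i · t i) ⊆ a · b
    from {x} x∈ =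
      -- Lifting `x` back to a product of the two factorisations yields some `a′` and `b′`; as the
      -- direct product is constrained, they can only be `a` and `b`.
      let a′ , b′ , a′∈ , b′∈ , x∈a′b′ = proj₂ (∏-⊙-∏ S T)
            (∏-mono (λ i → s i · t i) (λ i → S i ⊙ T i) (λ i y∈ → s i , t i , refl , refl , y∈) x∈)
      in subst₂ (λ y z → x ∈ y · z) (sym (proj₁ (constrained a s s∈ a∈) a′∈))
           (sym (proj₁ (constrained b t t∈ b∈) b′∈)) x∈a′b′

  -- With factor `i` in front, `e ∈ s i · c` for a product `c` of the other factors. Then `c` equals
  -- `s i`, which therefore lies in the trivial intersection of `Q i` with the complementary
  -- product.
  e-coordinates : ∀ s → (∀ i → s i ∈ Q i) → e ∈ ∏ₑ s → ∀ i → e ≡ s i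
  e-coordinates s s∈ e∈ i with ∏-removeAt (λ j → ｛ s j ｝) i e∈
  ... | _ , c , refl , c∈ , e∈sc with refl ← e∈a·b⇒a≡b e∈sc =
    proj₁ (IsDirectProduct.disjoint directProduct i)
      (s∈ i , ∏ₑ⊆∏ (removeAt Q i) {removeAt s i} (λ j → s∈ (punchIn i j)) c∈)

  -- Multiplying the two factorisations computes `a · a`, which contains `e`. So `e` has coordinates
  -- `u i ∈ s i · t i`; these are all trivial, and `e ∈ s i · t i` forces equality.
  coordinates-unique : ∀ s t {a} → (∀ i → s i ∈ Q i) → (∀ i → t i ∈ Q i) →
                       a ∈ ∏ₑ s → a ∈ ∏ₑ t → ∀ i → s i ≡ t i
  coordinates-unique s t {a} s∈ t∈ a∈s a∈t i =
    let u , u∈ , e∈u = factorisation (λ j → s j · t j)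
                         (proj₁ (·-coordinates s t s∈ t∈ a∈s a∈t) (e∈a·a a))
    in e∈a·b⇒a≡b (subst (_∈ s i · t i)
         (sym (e-coordinates u (λ j → Q-·-closed (s∈ j) (t∈ j) (u∈ j)) e∈u i)) (u∈ i))

  -- Squares `a · a` and idempotent elements, those with `a ∈ a · a`.

  square-coordinate : ∀ s {a} → (∀ i → s i ∈ Q i) → a ∈ ∏ₑ s → ∀ i → s i · s i ⊆ a · a
  square-coordinate s s∈ a∈ i x∈ = proj₂ (·-coordinates s s s∈ s∈ a∈ a∈)
    -- The coordinates other than `i` are filled by `e`, which lies in every `s j · s j`.
    (factor⊆∏ (λ j → s j · s j) (λ j → e∈a·a (s j)) i x∈)

  -- If `x` is not `e`, then `a` and `x` must both be `q i`.
  Q-square-idempotent : ∀ {i a x} → a ∈ Q i → x ∈ a · a → x ∈ x · x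
  Q-square-idempotent a∈ x∈ with Q⊆ a∈ | Q⊆ (Q-·-closed a∈ a∈ x∈)
  ... | _         | inj₁ refl = a∈e·a e
  ... | inj₂ refl | inj₂ refl = x∈
  ... | inj₁ refl | inj₂ refl = subst (λ y → _ ∈ y · y) (e·a⊆a x∈) x∈

  Q-square-⊙-closed : ∀ {i a} → a ∈ Q i → (a · a) ⊙ (a · a) ⊆ a · a
  Q-square-⊙-closed {i} {a} a∈ {x} (b , c , b∈ , c∈ , x∈) with Q⊆ (Q-·-closed a∈ a∈ b∈)
  ... | inj₁ refl = subst (_∈ a · a) (e·a⊆a x∈) c∈
  -- Now `q i ∈ a · a`, so `a · a` already contains both elements of `Q i`.
  ... | inj₂ refl with Q⊆ (Q-·-closed (q∈Q i) (Q-·-closed a∈ a∈ c∈) x∈)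
  ...   | inj₁ refl = e∈a·a a
  ...   | inj₂ refl = b∈

  square-closed : ∀ a → IsClosed (a · a)
  square-closed a = ·-closed⇒closed (e∈a·a a) λ x∈ → proj₂ a·a
    (∏-mono (λ i → S i ⊙ S i) S (λ i → Q-square-⊙-closed (s∈ i))
      (proj₁ (∏-⊙-∏ S S) (⊙-mono (proj₁ a·a) (proj₁ a·a) x∈)))
    where
    s   = proj₁ (coordinates a)
    s∈  = proj₁ (proj₂ (coordinates a))
    a∈  = proj₂ (proj₂ (coordinates a))
    a·a = ·-coordinates s s s∈ s∈ a∈ a∈
    S   = λ i → s i · s i

  -- Each coordinate `t i` of `x` lies in a factor square, hence is idempotent, so
  -- `t i ∈ t i · t i ⊆ x · x`. Thinness of `x` collapses this to `e`.
  thin-in-square : ∀ {a x} → x ∈ a · a → IsThin x → e ≡ x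
  thin-in-square {a} {x} x∈ thin =
    let s , s∈ , a∈ = coordinates a
        t , t∈ , x∈t = factorisation (λ i → s i · s i) (proj₁ (·-coordinates s s s∈ s∈ a∈ a∈) x∈)
        t≡e : ∀ i → e ≡ t i
        t≡e i = thin⇒a·a⊆｛e｝ thin
          (square-coordinate t (λ j → Q-·-closed (s∈ j) (s∈ j) (t∈ j)) x∈t i
            (Q-square-idempotent (s∈ i) (t∈ i)))
    in ∏⊆｛e｝ (λ i → ｛ t i ｝) (λ { i refl → t≡e i }) x∈t

  -- The square is closed and contains `a`, and a closed subset containing `a` contains its square.
  -- This also represents `⟨ ｛ a ｝ ⟩` at level `ℓ`, where closed subsets are quantified over.
  idempotent⇒⟨⟩≐square : ∀ {a} → a ∈ a · a → ⟨ ｛ a ｝ ⟩ ≐ a · a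
  idempotent⇒⟨⟩≐square {a} a∈ =
      (λ x∈ → x∈ (a · a) (square-closed a) λ { refl → a∈ })
    , (λ x∈ F F-closed a⊆ → ·-closed F-closed (a⊆ refl) (a⊆ refl) x∈)

  idempotent⇒thick : ∀ {a} → a ∈ a · a → a ≢ e → IsThick a
  idempotent⇒thick a∈ a≢e thin = a≢e (sym (thin⇒a·a⊆｛e｝ thin a∈))

  -- The largest idempotent in a closed subset.

  module ClosedSubset (em : ExcludedMiddle ℓ) {G : Pred Carrier ℓ} (G-closed : IsClosed G) where

    -- The choice is `q i` if it lies in `G` and is thick, expressed as `q i ∈ q i · q i`, and `e`
    -- otherwise.
    largest-idempotent-coordinate : ∀ i → ∃ λ s → s ∈ Q i × s ∈ G × s ∈ s · s ×
      (∀ {a x} → a ∈ Q i → x ∈ a · a → x ∈ G → x ∈ s · s)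
    largest-idempotent-coordinate i with em {q i ∈ G × q i ∈ q i · q i}
    ... | yes (q∈G , q∈qq) = q i , q∈Q i , q∈G , q∈qq , λ a∈ x∈ _ →
            [ (λ { refl → e∈a·a (q i) }) , (λ { refl → q∈qq }) ] (Q⊆ (Q-·-closed a∈ a∈ x∈))
    ... | no ¬q = e , e∈Q i , e∈closed G-closed , a∈e·a e , λ a∈ x∈ x∈G →
            [ (λ { refl → a∈e·a e })
            , (λ { refl → contradiction (x∈G , Q-square-idempotent a∈ x∈) ¬q })
            ] (Q⊆ (Q-·-closed a∈ a∈ x∈))

    largest-idempotent : ∃ λ r → r ∈ Thick U × r ∈ G × r ∈ r · r × (∀ {a} → a ∈ G → a · a ⊆ r · r)
    -- The support clause of `Thick` also covers `r ≡ e`, since supports exclude `e`.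
    largest-idempotent = r , (_ , inj₂ thick) , ∏ₑ⊆closed G-closed s∈G r∈
                           , proj₂ r·r (∏ₑ⊆∏ (λ i → s i · s i) s∈ss r∈) , squares⊆
      where
      s     = λ i → proj₁ (largest-idempotent-coordinate i)
      s∈    = λ i → proj₁ (proj₂ (largest-idempotent-coordinate i))
      s∈G   = λ i → proj₁ (proj₂ (proj₂ (largest-idempotent-coordinate i)))
      s∈ss  = λ i → proj₁ (proj₂ (proj₂ (proj₂ (largest-idempotent-coordinate i))))
      s-max = λ i {a x} → proj₂ (proj₂ (proj₂ (proj₂ (largest-idempotent-coordinate i)))) {a} {x}

      r   = proj₁ (∏ₑ-nonempty s)
      r∈  = proj₂ (∏ₑ-nonempty s)
      r·r = ·-coordinates s s s∈ s∈ r∈ r∈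

      thick : support r ⊆ IsThick
      -- Any factorisation `t` of `r` agrees with `s`, whose entries are idempotent.
      thick (t , t∈ , r∈t , (i , refl) , x≢e) = idempotent⇒thick
        (subst (λ y → y ∈ y · y) (coordinates-unique s t s∈ t∈ r∈ r∈t i) (s∈ss i)) x≢e

      squares⊆ : ∀ {a} → a ∈ G → a · a ⊆ r · r
      squares⊆ {a} a∈G x∈ with coordinates a
      -- The coordinates `t i` need not lie in `G`, but their squares do, being contained in
      -- `a · a`.
      ... | t , t∈ , a∈ = proj₂ r·r (∏-mono (λ i → t i · t i) (λ i → s i · s i)
              (λ i y∈ → s-max i (t∈ i) y∈
                 (·-closed G-closed a∈G a∈G (square-coordinate t t∈ a∈ i y∈)))
              (proj₁ (·-coordinates t t t∈ t∈ a∈ a∈) x∈))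

    -- Splitting an element into a thick and a thin factor.

    split-coordinate : ∀ {i a} → a ∈ Q i → ∃ λ t → ∃ λ f →
      a ∈ t · f × f ∈ Q i × t ∈ a · a × f · f ⊆ ｛ e ｝
    -- A coordinate goes whole to one side, to `t` if it is idempotent and to `f` otherwise; the
    -- other side gets `e`.
    split-coordinate {i} {a} a∈ with em {a ∈ a · a}
    ... | yes a∈aa = a , e , a∈a·e a , e∈Q i , a∈aa , e·a⊆a
    ... | no  a∉aa = e , a , a∈e·a a , a∈ , e∈a·a a , λ x∈ →
            [ (λ eq → eq)
            , (λ { refl → [ (λ { refl → e·a⊆a x∈ }) , (λ { refl → contradiction x∈ a∉aa }) ] (Q⊆ a∈) })
            ] (Q⊆ (Q-·-closed a∈ a∈ x∈))

    split : ∀ a → ∃ λ t → ∃ λ f → a ∈ t · f × t ∈ a · a × IsThin f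
    split a =
      -- Regrouping collects all `t i` into `a₁` and all `f i` into `a₂`.
      let a₁ , a₂ , a₁∈ , a₂∈ , a∈a₁a₂ =
            proj₂ (∏-⊙-∏ (λ i → ｛ t i ｝) (λ i → ｛ f i ｝))
              (∏-mono (λ i → ｛ s i ｝) (λ i → ｛ t i ｝ ⊙ ｛ f i ｝)
                (λ { i refl → t i , f i , refl , refl , a∈tf i }) a∈)
      in a₁ , a₂ , a∈a₁a₂
       , proj₂ (·-coordinates s s s∈ s∈ a∈ a∈) (∏ₑ⊆∏ (λ i → s i · s i) t∈ss a₁∈)
       , a·a⊆｛e｝⇒thin (λ x∈ → ∏⊆｛e｝ (λ i → f i · f i) ff⊆
                            (proj₁ (·-coordinates f f f∈ f∈ a₂∈ a₂∈) x∈))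
      where
      s     = proj₁ (coordinates a)
      s∈    = proj₁ (proj₂ (coordinates a))
      a∈    = proj₂ (proj₂ (coordinates a))
      t     = λ i → proj₁ (split-coordinate (s∈ i))
      f     = λ i → proj₁ (proj₂ (split-coordinate (s∈ i)))
      parts = λ i → proj₂ (proj₂ (split-coordinate (s∈ i)))
      a∈tf  = λ i → proj₁ (parts i)
      f∈    = λ i → proj₁ (proj₂ (parts i))
      t∈ss  = λ i → proj₁ (proj₂ (proj₂ (parts i)))
      ff⊆   = λ i {x} → proj₂ (proj₂ (proj₂ (parts i))) {x}

    -- Strong normality and the thin residue.

    square-stronglyNormal : ∀ {r} → r ∈ G → (∀ {a} → a ∈ G → a · a ⊆ r · r) →
                            IsStronglyNormalIn (r · r) ⟨ G ⟩
    square-stronglyNormal {r} r∈G squares⊆ = conj , λ x∈ K K-closed G⊆K →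
        ·-closed K-closed (G⊆K r∈G) (G⊆K r∈G) x∈
      where
      conj : ∀ a → a ∈ ⟨ G ⟩ → (｛ a ⋆ ｝ ⊙ (r · r)) ⊙ ｛ a ｝ ⊆ r · r
      -- By commutativity the conjugate of `r · r` by `a` is the product of `r · r` with the square
      -- of `a`, which already lies in `r · r`.
      conj a a∈ x∈
        with ⊙-assocˡ {F = r · r} {｛ a ⋆ ｝} {｛ a ｝}
               (⊙-mono (⊙-comm ｛ a ⋆ ｝ (r · r)) (λ y∈ → y∈) x∈)
      ... | b , c , b∈ , (_ , _ , refl , refl , c∈) , x∈bc =
        ·-closed (square-closed r) b∈
          (squares⊆ (a∈ G G-closed (λ y∈ → y∈)) (subst (λ y → c ∈ y · a) (a⋆≡a a) c∈)) x∈bc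

    -- Since `e ∈ F`, conjugating `F` by `r` yields all of `r ⋆ · r`. This contains `r` by
    -- idempotency, so strong normality puts `r` in `F`.
    idempotent⊆thinResidue : ∀ {r} → r ∈ G → r ∈ r · r → ⟨ ｛ r ｝ ⟩ ⊆ thinResidue G
    idempotent⊆thinResidue {r} r∈G r∈rr x∈ F F-closed (conj , _) = x∈ F F-closed λ { refl →
      conj r (⊆⟨⟩ G r∈G)
        ( r ⋆ , r , (r ⋆ , e , refl , e∈closed F-closed , a∈a·e (r ⋆)) , refl
        , subst (λ y → r ∈ y · r) (sym (a⋆≡a r)) r∈rr) }

    -- The decomposition of a closed subset.

    thinRadical-IsSubgroup : ᵞ-IsSubgroup (thinRadical G)
    thinRadical-IsSubgroup = (λ (a , (_ , thin) , X≐) → a , (_ , thin) , X≐) , record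
      { ε-closed  = e , (e∈closed G-closed , e-thin) , (λ x∈ → x∈) , (λ x∈ → x∈)
      ; ∙-closed  = λ { (a , (a∈ , ta) , X⊆ , ⊆X) (b , (b∈ , tb) , Y⊆ , ⊆Y) →
          let c , tc , ab⊆ , ⊆ab = thin-·-singleton ta tb
              _ , _ , a≡ , b≡ , c∈ab = ⊆ab refl
          in c , (·-closed G-closed (subst (_∈ G) a≡ a∈) (subst (_∈ G) b≡ b∈) c∈ab , tc)
               , (λ x∈ → ab⊆ (⊙-mono X⊆ Y⊆ x∈)) , (λ x∈ → ⊙-mono ⊆X ⊆Y (⊆ab x∈)) }
      ; ⁻¹-closed = λ { (a , a∈ , X⊆ , ⊆X) → a , a∈
          , (λ { (b , b∈ , refl) → trans (X⊆ b∈) (sym (a⋆≡a b)) })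
          , (λ { refl → a , ⊆X refl , sym (a⋆≡a a) }) }
      }

    module _ {r} (r∈G : r ∈ G) (r∈rr : r ∈ r · r) (squares⊆ : ∀ {a} → a ∈ G → a · a ⊆ r · r) where

      thinResidue≐ : thinResidue G ≐ ⟨ ｛ r ｝ ⟩
      thinResidue≐ =
          (λ x∈ → proj₂ (idempotent⇒⟨⟩≐square r∈rr)
            (x∈ (r · r) (square-closed r) (square-stronglyNormal r∈G squares⊆)))
        , idempotent⊆thinResidue r∈G r∈rr

      G≐⟨r⟩⊙thinRadical : G ≐ ⟨ ｛ r ｝ ⟩ ⊙ thinRadical G
      G≐⟨r⟩⊙thinRadical = to , λ { (_ , _ , t∈ , (f∈ , _) , x∈) →
          ·-closed G-closed (t∈ G G-closed λ { refl → r∈G }) f∈ x∈ }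
        where
        to : G ⊆ ⟨ ｛ r ｝ ⟩ ⊙ thinRadical G
        to {a} a∈G =
          let t , f , a∈tf , t∈aa , f-thin = split a
              -- Exchange turns `a ∈ t · f` into `f ∈ t ⋆ · a`, where `t` lies in `a · a` and so in
              -- `G`.
              f∈G = proj₂ G-closed
                ( t ⋆ , a , (t , ·-closed G-closed a∈G a∈G t∈aa , refl) , a∈G
                , Equivalence.to (exchange₃ a t f) a∈tf )
          in t , f , proj₂ (idempotent⇒⟨⟩≐square r∈rr) (squares⊆ a∈G t∈aa) , (f∈G , f-thin) , a∈tf

      ⟨r⟩∩thinRadical≐｛e｝ : ⟨ ｛ r ｝ ⟩ ∩ thinRadical G ≐ ｛ e ｝
      ⟨r⟩∩thinRadical≐｛e｝ =
          (λ (x∈ , _ , thin) → thin-in-square (proj₁ (idempotent⇒⟨⟩≐square r∈rr) x∈) thin)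
        , λ { refl → e∈closed (⟨⟩-closed ｛ r ｝) , e∈closed G-closed , e-thin }

    decomposition : ∃ λ r → ∃ λ (F : Pred Carrier ℓ) →
      r ∈ Thick U × thinResidue G ≐ ⟨ ｛ r ｝ ⟩ × ᵞ-IsSubgroup F × G ≐ ⟨ ｛ r ｝ ⟩ ⊙ F ×
      ⟨ ｛ r ｝ ⟩ ∩ F ≐ ｛ e ｝ × thinRadical G ≐ F
    decomposition =
      let r , r-thick , r∈G , r∈rr , squares⊆ = largest-idempotent in
        r , thinRadical G , r-thick
      , thinResidue≐ r∈G r∈rr squares⊆
      , thinRadical-IsSubgroup
      , G≐⟨r⟩⊙thinRadical r∈G r∈rr squares⊆
      , ⟨r⟩∩thinRadical≐｛e｝ r∈G r∈rr squares⊆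
      , (λ x∈ → x∈) , (λ x∈ → x∈)

  -- From a decomposition back to a closed subset.

  ᵞ-subgroup⇒closed : {F : Pred Carrier ℓ} → ᵞ-IsSubgroup F → IsClosed F
  ᵞ-subgroup⇒closed {F} (Fᵞ⊆ , F≤) = ·-closed⇒closed e∈F ⊙⊆
    where
    open IsSubgroup F≤

    singleton∈Fᵞ : ∀ {a} → a ∈ F → ｛ a ｝ ∈ F ᵞ
    singleton∈Fᵞ a∈ = _ , a∈ , (λ x∈ → x∈) , (λ x∈ → x∈)

    e∈F : e ∈ F
    e∈F with ε-closed
    ... | a , a∈ , e⊆ , _ = subst (_∈ F) (e⊆ refl) a∈

    ⊙⊆ : F ⊙ F ⊆ F
    ⊙⊆ {x} (b , c , b∈ , c∈ , x∈)
      with ∙-closed {｛ b ｝ , Fᵞ⊆ (singleton∈Fᵞ b∈)} {｛ c ｝ , Fᵞ⊆ (singleton∈Fᵞ c∈)}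
             (singleton∈Fᵞ b∈) (singleton∈Fᵞ c∈)
    -- The product of `｛ b ｝` and `｛ c ｝` is `｛ d ｝` with `d ∈ F`, so `x` is this `d`.
    ... | d , d∈ , bc⊆ , _ = subst (_∈ F) (bc⊆ (b , c , refl , refl , x∈)) d∈

  -- By interchange, `(F ⊙ K) ⊙ (F ⊙ K)` is contained in `(F ⊙ F) ⊙ (K ⊙ K)`.
  ⊙-closed : {F : Pred Carrier ℓ₁} {K : Pred Carrier ℓ₂} →
             IsClosed F → IsClosed K → IsClosed (F ⊙ K)
  ⊙-closed {F = F} {K} F-closed K-closed =
    ·-closed⇒closed (e , e , e∈closed F-closed , e∈closed K-closed , a∈e·a e) λ x∈ →
      ⊙-mono (λ (_ , _ , b∈ , c∈ , y∈) → ·-closed F-closed b∈ c∈ y∈)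
             (λ (_ , _ , b∈ , c∈ , y∈) → ·-closed K-closed b∈ c∈ y∈)
             (⊙-interchange F K F K x∈)

  -- Two levels are allowed because `⟨ ｛ r ｝ ⟩ ⊙ F` lives one universe above `G`.
  closed-resp-≐ : {F : Pred Carrier ℓ₁} {K : Pred Carrier ℓ₂} → F ≐ K → IsClosed K → IsClosed F
  closed-resp-≐ (F⊆ , ⊆F) K-closed = ·-closed⇒closed (⊆F (e∈closed K-closed))
    λ (_ , _ , b∈ , c∈ , x∈) → ⊆F (·-closed K-closed (F⊆ b∈) (F⊆ c∈) x∈)

theorem3p12 :
  {ℓ : Level} → ExcludedMiddle ℓ →
  (𝓗 : Hypergroup ℓ) (E : ElementaryAbelian2 𝓗) →
  let open Hypergroup 𝓗
      open ElementaryAbelian2 E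
  in
  (G : Pred Carrier ℓ) →
  IsClosed G ⇔
    (∃ λ (r : Carrier) → ∃ λ (F : Pred Carrier ℓ) →
      r ∈ Thick U ×
      thinResidue G ≐ ⟨ ｛ r ｝ ⟩ ×
      ᵞ-IsSubgroup F ×
      G ≐ ⟨ ｛ r ｝ ⟩ ⊙ F ×
      ⟨ ｛ r ｝ ⟩ ∩ F ≐ ｛ e ｝ ×
      thinRadical G ≐ F)
theorem3p12 em 𝓗 E G = mk⇔ (ClosedSubset.decomposition em)
  λ (r , F , _ , _ , F≤ , G≐ , _) →
    closed-resp-≐ G≐ (⊙-closed (⟨⟩-closed _) (ᵞ-subgroup⇒closed F≤))
  where
  open HypergroupProperties 𝓗
  open ElementaryAbelian2Properties E
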